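{- Let $\kappa$ be a regular uncountable cardinal and let $U$ be a $\sigma$-complete ultrafilter over $\kappa$ which is Dodd sound and is not a $p$-point. Then $U$ is non-Galvin.
   Context: $j_U:V\to M_U$ is the ultrapower embedding into the transitive collapse of the ultrapower, and $[f]_U$ is the element of $M_U$ represented by $f$. $U$ is Dodd sound if the function $P(\kappa)\to M_U$, $X\mapsto j_U(X)\cap[\mathrm{id}]_U$, belongs to $M_U$. A function $f:\kappa\to\kappa$ is unbounded mod $U$ if $f^{ -1}[\alpha]\notin U$ for all $\alpha<\kappa$; it is almost one-to-one mod $U$ if there is $A\in U$ such that $\{\alpha\in A\mid f(\alpha)=x\}$ is bounded in $\kappa$ for every $x$. $U$ is a $p$-point if every $f:\kappa\to\kappa$ that is unbounded mod $U$ is almost one-to-one mod $U$. A uniform ultrafilter $U$ over $\kappa$ has the Galvin property if for every sequence $\langle A_i\rangle_{i<2^\kappa}$ of members of $U$ there is $I\subseteq2^\kappa$ with $|I|=\kappa$ and $\bigcap_{i\in I}A_i\in U$; $U$ is non-Galvin if it does not have the Galvin property. -}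

module Defs where

open import Axiom.Extensionality.Propositional using (Extensionality)
open import Axiom.ExcludedMiddle using (ExcludedMiddle)
open import Data.Bool.Base using (Bool; true; false)
open import Data.Empty using (⊥; ⊥-elim)
open import Data.Maybe.Base using (Maybe; just; nothing; maybe)
open import Data.Nat.Base using (ℕ; zero; suc)
open import Data.Product.Base using (Σ; ∃; _×_; _,_; proj₁; proj₂)
open import Data.Sum.Base using (_⊎_)
open import Function.Base using (_∘_; const)
open import Function.Bundles using (Bijection; _⇔_; mk⇔; _↣_)
open import Function.Definitions using (Injective)
open import Induction.WellFounded using (Acc; acc; WellFounded)
open import Level using (0ℓ; Setω) renaming (suc to lsuc)
open import Relation.Binary.Core using (Rel)
open import Relation.Binary.PropositionalEquality using (_≡_; setoid)
open import Relation.Binary.Structures using (IsStrictTotalOrder)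
open import Relation.Nullary using (¬_; Dec; yes; no)
open import Relation.Unary
  using (Pred; _∈_; _⊆_; _∩_; ∁; ⋂) renaming (∅ to ∅ᴾ; U to Uᴾ)
open import Relation.Unary.Relation.Binary.Equality using (≐-setoid)

-- Since `Dec` is not truncated, excluded middle also picks
-- witnesses from inhabited types; with function extensionality it picks
-- representatives of equivalence classes (apply it to their characteristic
-- functions into Bool), so that the axiom of choice holds for V below.

record Classical : Setω where
  field
    em  : ∀ {ℓ} → ExcludedMiddle ℓ
    ext : ∀ {a b} → Extensionality a b

-- A cardinal κ is given by the well-ordered type K of the
-- ordinals below it.

-- The subset P has the cardinality of the type K.
∣_∣≡_ : {A : Set} → Pred A 0ℓ → Set → Set
∣_∣≡_ {A} P K = ∃ λ (e : K → A) →
  Injective _≡_ _≡_ e × (∀ x → x ∈ P ⇔ ∃ λ α → e α ≡ x)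

module _ {K : Set} (_<_ : Rel K 0ℓ) where

  Bounded : Pred (Pred K 0ℓ) 0ℓ
  Bounded P = ∃ λ β → ∀ α → α ∈ P → α < β

  record IsRegularUncountableCardinal : Set where
    field
      isStrictTotalOrder : IsStrictTotalOrder _≡_ _<_
      <-wellFounded      : WellFounded _<_
      isCardinal         : ∀ α → ¬ (∣ (_< α) ∣≡ K)
      -- No function from an ordinal α < κ to κ is cofinal.
      regular            : ∀ α (g : K → K) →
                           Bounded (λ β → ∃ λ γ → γ < α × g γ ≡ β)
      uncountable        : ¬ (K ↣ ℕ)

Family : Set → Set₁
Family K = Pred (Pred K 0ℓ) 0ℓ

module _ {K : Set} (𝒰 : Family K) where

  record IsUltrafilter : Set₁ where
    field
      whole  : Uᴾ ∈ 𝒰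
      proper : ¬ (∅ᴾ ∈ 𝒰)
      upward : ∀ {X Y} → X ⊆ Y → X ∈ 𝒰 → Y ∈ 𝒰
      inter  : ∀ {X Y} → X ∈ 𝒰 → Y ∈ 𝒰 → (X ∩ Y) ∈ 𝒰
      ultra  : ∀ X → X ∈ 𝒰 ⊎ ∁ X ∈ 𝒰

  σ-Complete : Set₁
  σ-Complete = (A : ℕ → Pred K 0ℓ) → (∀ n → A n ∈ 𝒰) → ⋂ ℕ A ∈ 𝒰

  -- 2^κ enters only as the size of the index set of a sequence, so Λ is any
  -- set in bijection with the power set of K.
  Galvin : Set₁
  Galvin = (Λ : Set) → Bijection (setoid Λ) (≐-setoid K 0ℓ) →
    (A : Λ → Pred K 0ℓ) → (∀ i → A i ∈ 𝒰) →
    ∃ λ (I : Pred Λ 0ℓ) → (∣ I ∣≡ K) × (λ α → ∀ i → i ∈ I → α ∈ A i) ∈ 𝒰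

  NonGalvin : Set₁
  NonGalvin = ¬ Galvin

  module _ (_<_ : Rel K 0ℓ) where

    UnboundedMod : Pred (K → K) 0ℓ
    UnboundedMod f = ∀ α → ¬ ((λ β → f β < α) ∈ 𝒰)

    AlmostOneToOneMod : Pred (K → K) (lsuc 0ℓ)
    AlmostOneToOneMod f = ∃ λ (A : Pred K 0ℓ) → A ∈ 𝒰 ×
      (∀ x → Bounded _<_ (λ α → α ∈ A × f α ≡ x))

    PPoint : Set₁
    PPoint = ∀ f → UnboundedMod f → AlmostOneToOneMod f

-- V consists of Aczel's iterative sets; equality of sets is _≈_.

infix 4 _≈_ _∈ⱽ_ _⊆ⱽ_

data V : Set₁ where
  sup : (I : Set) → (I → V) → V

index : V → Set
index (sup I _) = I

element : (x : V) → index x → V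
element (sup _ x) = x

_≈_ : V → V → Set
sup I x ≈ sup J y = (∀ i → ∃ λ j → x i ≈ y j) × (∀ j → ∃ λ i → x i ≈ y j)

_∈ⱽ_ : V → V → Set
x ∈ⱽ y = ∃ λ j → x ≈ element y j

_⊆ⱽ_ : V → V → Set₁
x ⊆ⱽ y = ∀ z → z ∈ⱽ x → z ∈ⱽ y

∅ⱽ : V
∅ⱽ = sup ⊥ ⊥-elim

_∩ⱽ_ : V → V → V
x ∩ⱽ y = sup (∃ λ i → element x i ∈ⱽ y) (element x ∘ proj₁)

[_,_]ⱽ : V → V → V
[ x , y ]ⱽ = sup Bool λ { false → x ; true → y }

⟨_,_⟩ⱽ : V → V → V
⟨ x , y ⟩ⱽ = [ [ x , x ]ⱽ , [ x , y ]ⱽ ]ⱽ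

≈-refl : ∀ x → x ≈ x
≈-refl (sup I x) = (λ i → i , ≈-refl (x i)) , (λ i → i , ≈-refl (x i))

≈-sym : ∀ x y → x ≈ y → y ≈ x
≈-sym (sup I x) (sup J y) (p , q) =
  (λ j → proj₁ (q j) , ≈-sym _ _ (proj₂ (q j))) ,
  (λ i → proj₁ (p i) , ≈-sym _ _ (proj₂ (p i)))

≈-trans : ∀ x y z → x ≈ y → y ≈ z → x ≈ z
≈-trans (sup I x) (sup J y) (sup L z) (p , q) (p′ , q′) =
  (λ i → let (j , a) = p i ; (l , b) = p′ j in l , ≈-trans _ _ _ a b) ,
  (λ l → let (j , b) = q′ l ; (i , a) = q j in i , ≈-trans _ _ _ a b)

∈-resp : ∀ x y z → x ≈ y → z ∈ⱽ x → z ∈ⱽ y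
∈-resp (sup I x) (sup J y) z (p , _) (i , a) =
  proj₁ (p i) , ≈-trans z _ _ a (proj₂ (p i))

∈-respˡ : ∀ {x y} z → x ≈ y → y ∈ⱽ z → x ∈ⱽ z
∈-respˡ z p (i , a) = i , ≈-trans _ _ _ p a

no-descent : ∀ x (s : ℕ → V) → s 0 ≈ x → ¬ (∀ n → s (suc n) ∈ⱽ s n)
no-descent (sup I x) s p d with ∈-resp (s 0) (sup I x) (s 1) p (d 0)
... | i , q = no-descent (x i) (s ∘ suc) q (d ∘ suc)

module _ {K : Set} {_<_ : Rel K 0ℓ} where

  ordinalAcc : ∀ α → Acc _<_ α → V
  ordinalAcc α (acc rs) =
    sup (∃ λ β → β < α) (λ (β , β<α) → ordinalAcc β (rs β<α))

  module _ (κ : IsRegularUncountableCardinal _<_) where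

    open IsRegularUncountableCardinal κ

    ordinal : K → V
    ordinal α = ordinalAcc α (<-wellFounded α)

    κⱽ : V
    κⱽ = sup K ordinal

-- The ultrapower of V is represented by the functions K → V with the equality
-- _=ᵁ_ and the membership _∈ᵁ_.

module _ {K : Set} (𝒰 : Family K) where

  _=ᵁ_ : Rel (K → V) 0ℓ
  f =ᵁ g = (λ α → f α ≈ g α) ∈ 𝒰

  _∈ᵁ_ : Rel (K → V) 0ℓ
  f ∈ᵁ g = (λ α → f α ∈ⱽ g α) ∈ 𝒰

  -- The members of f in the ultrapower form a proper class of functions, but
  -- up to =ᵁ each is a choice of elements of the f α where there are any,
  -- extended by ∅; these form a set.
  choose : (f : K → V) → (∀ α → Maybe (index (f α))) → K → V
  choose f s α = maybe (element (f α)) ∅ⱽ (s α)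

  collapseAcc : ∀ f → Acc _∈ᵁ_ f → V
  collapseAcc f (acc rs) =
    sup (∃ λ s → choose f s ∈ᵁ f) (λ (s , m) → collapseAcc (choose f s) (rs m))

  module _ (em : ∀ {ℓ} → ExcludedMiddle ℓ)
           (uf : IsUltrafilter 𝒰) where

    open IsUltrafilter uf

    ∈ᵁ-wellFounded : σ-Complete 𝒰 → WellFounded _∈ᵁ_
    ∈ᵁ-wellFounded σ f with em {P = Acc _∈ᵁ_ f}
    ... | yes a = a
    ... | no ¬a = ⊥-elim (proper (upward
                    (λ {α} d → no-descent (seq 0 α) (λ n → seq n α) (≈-refl _) d)
                    (σ (λ n α → seq (suc n) α ∈ⱽ seq n α) descends)))
      where
      Bad : Set₁
      Bad = ∃ λ g → ¬ Acc _∈ᵁ_ g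

      step : (b : Bad) → ∃ λ (c : Bad) → proj₁ c ∈ᵁ proj₁ b
      step (g , ¬acc) with em {P = ∃ λ (c : Bad) → proj₁ c ∈ᵁ g}
      ... | yes c = c
      ... | no ¬c = ⊥-elim (¬acc (acc below))
        where
        below : ∀ {h} → h ∈ᵁ g → Acc _∈ᵁ_ h
        below {h} h∈g with em {P = Acc _∈ᵁ_ h}
        ... | yes a = a
        ... | no ¬b = ⊥-elim (¬c ((h , ¬b) , h∈g))

      bad : ℕ → Bad
      bad zero    = f , ¬a
      bad (suc n) = proj₁ (step (bad n))

      seq : ℕ → K → V
      seq n = proj₁ (bad n)

      descends : ∀ n → seq (suc n) ∈ᵁ seq n
      descends n = proj₂ (step (bad n))

    restrict : ∀ f g → g ∈ᵁ f →
               ∃ λ s → (choose f s ∈ᵁ f) × (g =ᵁ choose f s)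
    restrict f g m =
      s , upward (λ {α} p → ∈-respˡ (f α) (≈-sym _ _ (eq α p)) p) m
        , upward (λ {α} → eq α) m
      where
      pick : ∀ {α} → Dec (g α ∈ⱽ f α) → Maybe (index (f α))
      pick (yes (i , _)) = just i
      pick (no _)        = nothing

      s : ∀ α → Maybe (index (f α))
      s α = pick em

      eq : ∀ α → g α ∈ⱽ f α → g α ≈ choose f s α
      eq α p with em {P = g α ∈ⱽ f α}
      ... | yes (_ , q) = q
      ... | no ¬p       = ⊥-elim (¬p p)

    private
      half : ∀ f g (a : Acc _∈ᵁ_ f) (b : Acc _∈ᵁ_ g) → f =ᵁ g →
             ∀ i → ∃ λ j → element (collapseAcc f a) i ≈
                           element (collapseAcc g b) j

    collapse-cong : ∀ f g (a : Acc _∈ᵁ_ f) (b : Acc _∈ᵁ_ g) → f =ᵁ g →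
                    collapseAcc f a ≈ collapseAcc g b

    half f g (acc a) (acc b) e (s , m) =
      let m′ = upward (λ {α} (p , q) → ∈-resp (f α) (g α) _ q p) (inter m e)
          (t , n , e′) = restrict g (choose f s) m′
      in (t , n) , collapse-cong _ _ (a m) (b n) e′

    collapse-cong f g a@(acc _) b@(acc _) e =
      half f g a b e ,
      λ j → let (i , p) = half g f b a (upward (≈-sym _ _) e) j
            in i , ≈-sym _ _ p

    module _ (σ : σ-Complete 𝒰) where

      -- The element [ f ] of M represented by f
      [_] : (K → V) → V
      [ f ] = collapseAcc f (∈ᵁ-wellFounded σ f)

      -- The defining property of the transitive collapse
      ∈-collapse : ∀ f y → y ∈ⱽ [ f ] ⇔ ∃ λ g → g ∈ᵁ f × y ≈ [ g ]
      ∈-collapse f y = mk⇔ to from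
        where
        to : y ∈ⱽ [ f ] → ∃ λ g → g ∈ᵁ f × y ≈ [ g ]
        to p with ∈ᵁ-wellFounded σ f
        to ((s , m) , q) | acc rs =
          choose f s , m ,
          ≈-trans y _ _ q (collapse-cong _ _ _ _ (upward (λ _ → ≈-refl _) whole))

        from : (∃ λ g → g ∈ᵁ f × y ≈ [ g ]) → y ∈ⱽ [ f ]
        from (g , m , q) with ∈ᵁ-wellFounded σ f
        ... | acc rs = let (s , n , e) = restrict f g m in
          (s , n) , ≈-trans y _ _ q (collapse-cong _ _ _ _ e)

      M : Pred V (lsuc 0ℓ)
      M y = ∃ λ f → y ≈ [ f ]

      j : V → V
      j x = [ const x ]

      -- The function X ↦ j X ∩ [id] on P(κ), as a set of ordered pairs, is a
      -- member of M.
      DoddSound : {_<_ : Rel K 0ℓ} → IsRegularUncountableCardinal _<_ → Set₁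
      DoddSound κ = ∃ λ d → d ∈ M ×
        (∀ z → z ∈ⱽ d ⇔
          ∃ λ X → X ⊆ⱽ κⱽ κ × z ≈ ⟨ X , j X ∩ⱽ [ ordinal κ ] ⟩ⱽ)

{-# OPTIONS --safe #-}

-- Write [id] for the class of the identity. By Dodd soundness the set
-- { j X ∩ [id] | X ⊆ κ } is represented by some α ↦ 𝒜 α: almost everywhere
-- X ∩ α ∈ 𝒜 α for every X ⊆ κ, and every function y with y α ∈ 𝒜 α almost
-- everywhere is almost everywhere of the form y α = Y ∩ α for a fixed Y. Let f
-- be unbounded and not almost one-to-one, and suppose that for κ many distinct
-- sets X_γ the set of α with X_γ ∩ α ∈ 𝒜 α for all γ is in U. Then
-- X_{f α} ∩ α = Y ∩ α almost everywhere for some Y. As f is not almost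
-- one-to-one, almost every α has cofinally many such α′ with f α′ = f α, whence
-- X_{f α} = Y. Thus f is constant almost everywhere, a contradiction.

module Submission where

open import Defs
open import Axiom.Extensionality.Propositional using (Extensionality)
open import Axiom.ExcludedMiddle using (ExcludedMiddle)
open import Data.Bool.Base using (Bool; true; false; T)
open import Data.Empty using (⊥; ⊥-elim)
open import Data.Product.Base using (∃; _×_; _,_; proj₁; proj₂)
open import Data.Sum.Base using (_⊎_; inj₁; inj₂)
open import Data.Unit.Base using (tt)
open import Function.Base using (_∘_; const)
open import Function.Bundles using (Bijection; Equivalence)
open import Induction.WellFounded using (Acc; acc)
open import Level using (0ℓ)
open import Relation.Binary.Core using (Rel)
open import Relation.Binary.Definitions using (tri<; tri≈; tri>)
open import Relation.Binary.PropositionalEquality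
  using (_≡_; refl; sym; trans; cong; subst; setoid)
open import Relation.Binary.Structures using (IsStrictTotalOrder)
open import Relation.Nullary using (¬_; Dec; yes; no)
open import Relation.Nullary.Decidable
  using (decidable-stable; toWitness; fromWitness; ⌊_⌋)
open import Relation.Unary using (Pred; _∈_; _∩_; ∁)
open import Relation.Unary.Relation.Binary.Equality using (≐-setoid)

-- Extensionality, intersections and ordered pairs in `V`.

element-∈ : ∀ x i → element x i ∈ⱽ x
element-∈ x i = i , ≈-refl _

≈-extensional : ∀ x y → (∀ i → element x i ∈ⱽ y) → (∀ j → element y j ∈ⱽ x) →
                x ≈ y
≈-extensional (sup I x) (sup J y) p q =
  p , λ j → let (i , e) = q j in i , ≈-sym _ _ e

∈-irrefl : ∀ x → ¬ (x ∈ⱽ x)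
∈-irrefl x m = no-descent x (const x) (≈-refl x) (const m)

∈-∩⁺ : ∀ {z} x y → z ∈ⱽ x → z ∈ⱽ y → z ∈ⱽ (x ∩ⱽ y)
∈-∩⁺ x y (i , p) q = (i , ∈-respˡ y (≈-sym _ _ p) q) , p

∈-∩⁻ : ∀ {z} x y → z ∈ⱽ (x ∩ⱽ y) → z ∈ⱽ x × z ∈ⱽ y
∈-∩⁻ x y ((i , q) , p) = (i , p) , ∈-respˡ y p q

∈-[,]⁻ : ∀ {z} x y → z ∈ⱽ [ x , y ]ⱽ → z ≈ x ⊎ z ≈ y
∈-[,]⁻ x y (false , p) = inj₁ p
∈-[,]⁻ x y (true  , p) = inj₂ p

[,]-cong : ∀ {x x′ y y′} → x ≈ x′ → y ≈ y′ → [ x , y ]ⱽ ≈ [ x′ , y′ ]ⱽ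
[,]-cong p q = (λ { false → false , p ; true → true , q }) ,
               (λ { false → false , p ; true → true , q })

⟨,⟩-cong : ∀ {x x′ y y′} → x ≈ x′ → y ≈ y′ → ⟨ x , y ⟩ⱽ ≈ ⟨ x′ , y′ ⟩ⱽ
⟨,⟩-cong p q = [,]-cong ([,]-cong p p) ([,]-cong p q)

[,]-injective : ∀ {x x′ y y′} → [ x , y ]ⱽ ≈ [ x′ , y′ ]ⱽ →
                (x ≈ x′ × y ≈ y′) ⊎ (x ≈ y′ × y ≈ x′)
[,]-injective (p , q) with p false | p true
... | false , a | true  , b = inj₁ (a , b)
... | true  , a | false , b = inj₂ (a , b)
... | false , a | false , b with q true
...   | false , c = inj₂ (c , b)
...   | true  , c = inj₁ (a , c)
[,]-injective (p , q) | true  , a | true  , b with q false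
...   | false , c = inj₁ (c , b)
...   | true  , c = inj₂ (a , c)

⟨,⟩-injectiveʳ : ∀ {x x′ y y′} → ⟨ x , y ⟩ⱽ ≈ ⟨ x′ , y′ ⟩ⱽ → y ≈ y′
⟨,⟩-injectiveʳ e with [,]-injective e
... | inj₁ (p , q) with [,]-injective q
...   | inj₁ (_ , y≈y′) = y≈y′
...   | inj₂ (x≈y′ , y≈x′) with [,]-injective p
...     | inj₁ (x≈x′ , _) =
          ≈-trans _ _ _ y≈x′ (≈-trans _ _ _ (≈-sym _ _ x≈x′) x≈y′)
...     | inj₂ (x≈x′ , _) =
          ≈-trans _ _ _ y≈x′ (≈-trans _ _ _ (≈-sym _ _ x≈x′) x≈y′)
-- In the crossed case each pair contains a singleton matched with the other's doubleton, so all
-- four coordinates coincide.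
⟨,⟩-injectiveʳ {x} {x′} {y} {y′} e | inj₂ (p , q) = ≈-trans _ _ _ y≈x′ x′≈y′
  where
  y≈x′ : y ≈ x′
  y≈x′ with [,]-injective q
  ... | inj₁ (_ , b) = b
  ... | inj₂ (_ , b) = b

  x′≈y′ : x′ ≈ y′
  x′≈y′ with [,]-injective p
  ... | inj₁ (a , b) = ≈-trans _ _ _ (≈-sym _ _ a) b
  ... | inj₂ (a , b) = ≈-trans _ _ _ (≈-sym _ _ b) a

-- Ordinals below κ and subsets of κ as sets.

module _ {K : Set} {_<_ : Rel K 0ℓ} (κ : IsRegularUncountableCardinal _<_) where

  open IsRegularUncountableCardinal κ
  open IsStrictTotalOrder isStrictTotalOrder using (compare)

  -- If something lies below `α`, regularity bounds the constant map with value `α`. Otherwise a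
  -- maximal `α` would be the only element of `K`, which would then be countable.
  no-maximum : ExcludedMiddle 0ℓ → ∀ α → ∃ λ β → α < β
  no-maximum em α with em {P = ∃ λ β → α < β}
  ... | yes p = p
  ... | no ¬p with em {P = ∃ λ β → β < α}
  ...   | yes (γ , γ<α) = let (β , b) = regular α (const α) in
                          β , b α (γ , γ<α , refl)
  ...   | no ¬q = ⊥-elim (uncountable record
                    { to        = const 0
                    ; cong      = λ _ → refl
                    ; injective = λ {x} {y} _ → trans (≡α x) (sym (≡α y)) })
    where
    ≡α : ∀ x → x ≡ α
    ≡α x with compare x α
    ... | tri< x<α _ _ = ⊥-elim (¬q (x , x<α))
    ... | tri≈ _ x≡α _ = x≡α
    ... | tri> _ _ α<x = ⊥-elim (¬p (x , α<x))

  ordinalAcc-irrelevant : ∀ α (a b : Acc _<_ α) → ordinalAcc α a ≈ ordinalAcc α b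
  ordinalAcc-irrelevant α (acc a) (acc b) =
    (λ (β , β<α) → (β , β<α) , ordinalAcc-irrelevant β (a β<α) (b β<α)) ,
    (λ (β , β<α) → (β , β<α) , ordinalAcc-irrelevant β (a β<α) (b β<α))

  ordinal-mono : ∀ {α β} → α < β → ordinal κ α ∈ⱽ ordinal κ β
  ordinal-mono {α} {β} α<β with <-wellFounded β
  ... | acc rs = (α , α<β) , ordinalAcc-irrelevant α _ _

  ordinal-injective : ∀ {α β} → ordinal κ α ≈ ordinal κ β → α ≡ β
  ordinal-injective {α} {β} e with compare α β
  ... | tri< α<β _ _ =
    ⊥-elim (∈-irrefl _ (∈-respˡ (ordinal κ β) (≈-sym _ _ e) (ordinal-mono α<β)))
  ... | tri≈ _ α≡β _ = α≡β
  ... | tri> _ _ β<α =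
    ⊥-elim (∈-irrefl _ (∈-respˡ (ordinal κ α) e (ordinal-mono β<α)))

  subsetⱽ : Pred K 0ℓ → V
  subsetⱽ P = sup (∃ P) (ordinal κ ∘ proj₁)

  subsetⱽ-⊆ : ∀ P → subsetⱽ P ⊆ⱽ κⱽ κ
  subsetⱽ-⊆ P z ((α , _) , e) = α , e

  ordinal-∈-subsetⱽ⁺ : ∀ {P α} → α ∈ P → ordinal κ α ∈ⱽ subsetⱽ P
  ordinal-∈-subsetⱽ⁺ {α = α} p = (α , p) , ≈-refl _

  ordinal-∈-subsetⱽ⁻ : ∀ {P α} → ordinal κ α ∈ⱽ subsetⱽ P → α ∈ P
  ordinal-∈-subsetⱽ⁻ {P} ((β , p) , e) = subst P (sym (ordinal-injective e)) p

  ordinal-∈-resp : ∀ x y {α β} → (x ∩ⱽ ordinal κ α) ≈ (y ∩ⱽ ordinal κ α) →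
                   β < α → ordinal κ β ∈ⱽ x → ordinal κ β ∈ⱽ y
  ordinal-∈-resp x y {α} e β<α m = proj₁ (∈-∩⁻ y (ordinal κ α)
    (∈-resp (x ∩ⱽ ordinal κ α) (y ∩ⱽ ordinal κ α) _ e
      (∈-∩⁺ x (ordinal κ α) m (ordinal-mono β<α))))

-- Ultrafilters, fibres, and inclusion in the ultrapower.

module _ {K : Set} {𝒰 : Family K} (uf : IsUltrafilter 𝒰) where

  open IsUltrafilter uf

  ¬∁⇒∈ : ∀ {X : Pred K 0ℓ} → ¬ (∁ X ∈ 𝒰) → X ∈ 𝒰
  ¬∁⇒∈ {X} ¬c with ultra X
  ... | inj₁ m = m
  ... | inj₂ c = ⊥-elim (¬c c)

  disjoint : ∀ {X Y : Pred K 0ℓ} → X ∈ 𝒰 → Y ∈ 𝒰 → (∀ {α} → α ∈ X → ¬ (α ∈ Y)) → ⊥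
  disjoint m n d = proper (upward (λ (p , q) → d p q) (inter m n))

  =ᵁ-sym : ∀ {f g} → _=ᵁ_ 𝒰 f g → _=ᵁ_ 𝒰 g f
  =ᵁ-sym = upward (≈-sym _ _)

  ∈ᵁ-respˡ : ∀ {f g h} → _=ᵁ_ 𝒰 f g → _∈ᵁ_ 𝒰 g h → _∈ᵁ_ 𝒰 f h
  ∈ᵁ-respˡ {h = h} e m =
    upward (λ {α} (p , q) → ∈-respˡ (h α) p q) (inter e m)

  -- Otherwise the points of `C` whose fibre within `C` is bounded would form a member of `𝒰`
  -- witnessing that `f` is almost one-to-one.
  fibre-unbounded : ExcludedMiddle 0ℓ → {_<_ : Rel K 0ℓ} {f : K → K} →
    ¬ AlmostOneToOneMod 𝒰 _<_ f → ∀ {C} → C ∈ 𝒰 →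
    (λ α → ¬ Bounded _<_ (λ β → β ∈ C × f β ≡ f α)) ∈ 𝒰
  fibre-unbounded em {_<_} {f} ¬a {C} m
    with ultra (λ α → Bounded _<_ (λ β → β ∈ C × f β ≡ f α))
  ... | inj₂ u = u
  ... | inj₁ b = ⊥-elim (¬a (_ , inter m b , bounded))
    where
    A : Pred K 0ℓ
    A = C ∩ (λ α → Bounded _<_ (λ β → β ∈ C × f β ≡ f α))

    bounded : ∀ x → Bounded _<_ (λ α → α ∈ A × f α ≡ x)
    bounded x with em {P = ∃ λ α → α ∈ A × f α ≡ x}
    ... | yes (_ , (_ , β , h) , refl) = β , λ α ((c , _) , e) → h α (c , e)
    -- An empty fibre is bounded by anything; `x` serves as an arbitrary bound.
    ... | no ¬e = x , λ α p → ⊥-elim (¬e (α , p))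

  module _ (em : ∀ {ℓ} → ExcludedMiddle ℓ) where

    -- Łoś's theorem for inclusion: if it failed almost everywhere, choosing a counterexample
    -- wherever one exists would give an `h` that is almost everywhere in `f` and outside `g`.
    ⊆ᵁ⇒pointwise : ∀ f g → (∀ h → _∈ᵁ_ 𝒰 h f → _∈ᵁ_ 𝒰 h g) →
                   (λ α → ∀ i → element (f α) i ∈ⱽ g α) ∈ 𝒰
    ⊆ᵁ⇒pointwise f g sub = ¬∁⇒∈ λ c →
      disjoint (sub h (upward (proj₁ ∘ h-spec) c)) (upward (proj₂ ∘ h-spec) c)
        (λ p q → q p)
      where
      Witness : K → Set
      Witness α = ∃ λ i → ¬ (element (f α) i ∈ⱽ g α)

      pick : ∀ {α} → Dec (Witness α) → V
      pick {α} (yes (i , _)) = element (f α) i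
      pick     (no _)        = ∅ⱽ

      h : K → V
      h α = pick (em {P = Witness α})

      h-spec : ∀ {α} → ¬ (∀ i → element (f α) i ∈ⱽ g α) →
               h α ∈ⱽ f α × ¬ (h α ∈ⱽ g α)
      h-spec {α} ¬s with em {P = Witness α}
      ... | yes (i , ¬m) = element-∈ (f α) i , ¬m
      ... | no ¬w = ⊥-elim (¬s λ i → decidable-stable em (λ ¬m → ¬w (i , ¬m)))

    -- Łoś's theorem for the collapse.

    module _ (σ : σ-Complete 𝒰) where

      private
        infix 10 ⟦_⟧
        ⟦_⟧ : (K → V) → V
        ⟦ f ⟧ = [_] 𝒰 em uf σ f

      ⟦⟧-cong : ∀ {f g} → _=ᵁ_ 𝒰 f g → ⟦ f ⟧ ≈ ⟦ g ⟧
      ⟦⟧-cong = collapse-cong 𝒰 em uf _ _ _ _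

      ∈-⟦⟧⁻ : ∀ f {y} → y ∈ⱽ ⟦ f ⟧ → ∃ λ g → _∈ᵁ_ 𝒰 g f × y ≈ ⟦ g ⟧
      ∈-⟦⟧⁻ f = Equivalence.to (∈-collapse 𝒰 em uf σ f _)

      ∈-⟦⟧⁺ : ∀ f {y} g → _∈ᵁ_ 𝒰 g f → y ≈ ⟦ g ⟧ → y ∈ⱽ ⟦ f ⟧
      ∈-⟦⟧⁺ f g m e = Equivalence.from (∈-collapse 𝒰 em uf σ f _) (g , m , e)

      -- Induction along `_∈ᵁ_`: the hypothesis identifies members of `f` and `g` with equal
      -- collapses, and inclusion in the ultrapower is pointwise almost everywhere.
      ⟦⟧-injective : ∀ f g → ⟦ f ⟧ ≈ ⟦ g ⟧ → _=ᵁ_ 𝒰 f g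
      ⟦⟧-injective f = go f (∈ᵁ-wellFounded 𝒰 em uf σ f)
        where
        go : ∀ f → Acc (_∈ᵁ_ 𝒰) f → ∀ g → ⟦ f ⟧ ≈ ⟦ g ⟧ → _=ᵁ_ 𝒰 f g
        go f (acc rs) g e =
          upward (λ {α} (p , q) → ≈-extensional (f α) (g α) p q)
            (inter (⊆ᵁ⇒pointwise f g f⊆g) (⊆ᵁ⇒pointwise g f g⊆f))
          where
          f⊆g : ∀ h → _∈ᵁ_ 𝒰 h f → _∈ᵁ_ 𝒰 h g
          f⊆g h m =
            let (h′ , m′ , e′) = ∈-⟦⟧⁻ g (∈-resp ⟦ f ⟧ ⟦ g ⟧ _ e
                                   (∈-⟦⟧⁺ f h m (≈-refl _)))
            in ∈ᵁ-respˡ {h = g} (go h (rs m) h′ e′) m′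

          g⊆f : ∀ h → _∈ᵁ_ 𝒰 h g → _∈ᵁ_ 𝒰 h f
          g⊆f h m =
            let (h′ , m′ , e′) = ∈-⟦⟧⁻ f (∈-resp ⟦ g ⟧ ⟦ f ⟧ _ (≈-sym _ _ e)
                                   (∈-⟦⟧⁺ g h m (≈-refl _)))
            -- The induction is over members of `f`, so here it applies to `h′` and its result is
            -- reversed.
            in ∈ᵁ-respˡ {h = f}
                 (=ᵁ-sym (go h′ (rs m′) h (≈-sym _ _ e′))) m′

      ⟦⟧-∈⁻ : ∀ f g → ⟦ f ⟧ ∈ⱽ ⟦ g ⟧ → _∈ᵁ_ 𝒰 f g
      ⟦⟧-∈⁻ f g m = let (f′ , m′ , e) = ∈-⟦⟧⁻ g m in
        ∈ᵁ-respˡ {h = g} (⟦⟧-injective f f′ e) m′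

      ⟦⟧-∩ : ∀ f g → (⟦ f ⟧ ∩ⱽ ⟦ g ⟧) ≈ ⟦ (λ α → f α ∩ⱽ g α) ⟧
      ⟦⟧-∩ f g = ≈-extensional _ _ to from
        where
        f∩g : K → V
        f∩g α = f α ∩ⱽ g α

        to : ∀ i → element (⟦ f ⟧ ∩ⱽ ⟦ g ⟧) i ∈ⱽ ⟦ f∩g ⟧
        to i =
          let (mf , mg)    = ∈-∩⁻ ⟦ f ⟧ ⟦ g ⟧ (element-∈ (⟦ f ⟧ ∩ⱽ ⟦ g ⟧) i)
              (h , h∈f , e) = ∈-⟦⟧⁻ f mf
              h∈g           = ⟦⟧-∈⁻ h g (∈-respˡ ⟦ g ⟧ (≈-sym _ _ e) mg)
          in ∈-⟦⟧⁺ f∩g h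
               (upward (λ {α} (p , q) → ∈-∩⁺ (f α) (g α) p q) (inter h∈f h∈g)) e

        from : ∀ j → element ⟦ f∩g ⟧ j ∈ⱽ (⟦ f ⟧ ∩ⱽ ⟦ g ⟧)
        from j =
          let (h , m , e) = ∈-⟦⟧⁻ f∩g (element-∈ ⟦ f∩g ⟧ j)
          in ∈-∩⁺ ⟦ f ⟧ ⟦ g ⟧
               (∈-⟦⟧⁺ f h (upward (λ {α} p → proj₁ (∈-∩⁻ (f α) (g α) p)) m) e)
               (∈-⟦⟧⁺ g h (upward (λ {α} p → proj₂ (∈-∩⁻ (f α) (g α) p)) m) e)

      ⟦⟧-[,] : ∀ f g → [ ⟦ f ⟧ , ⟦ g ⟧ ]ⱽ ≈ ⟦ (λ α → [ f α , g α ]ⱽ) ⟧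
      ⟦⟧-[,] f g = ≈-extensional _ _ to from
        where
        f,g : K → V
        f,g α = [ f α , g α ]ⱽ

        to : ∀ i → element [ ⟦ f ⟧ , ⟦ g ⟧ ]ⱽ i ∈ⱽ ⟦ f,g ⟧
        to false = ∈-⟦⟧⁺ f,g f (upward (λ _ → false , ≈-refl _) whole) (≈-refl _)
        to true  = ∈-⟦⟧⁺ f,g g (upward (λ _ → true  , ≈-refl _) whole) (≈-refl _)

        from : ∀ j → element ⟦ f,g ⟧ j ∈ⱽ [ ⟦ f ⟧ , ⟦ g ⟧ ]ⱽ
        from j with ∈-⟦⟧⁻ f,g (element-∈ ⟦ f,g ⟧ j)
        -- The ultrafilter decides which of the two pointwise alternatives holds almost everywhere.
        ... | h , m , e with ultra (λ α → h α ≈ f α)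
        ...   | inj₁ h=f = false , ≈-trans _ _ _ e (⟦⟧-cong h=f)
        ...   | inj₂ h≠f = true  , ≈-trans _ _ _ e (⟦⟧-cong
                  (upward (λ {α} → other α) (inter m h≠f)))
          where
          other : ∀ α → h α ∈ⱽ f,g α × ¬ (h α ≈ f α) → h α ≈ g α
          other α (m , ¬p) with ∈-[,]⁻ (f α) (g α) m
          ... | inj₁ p = ⊥-elim (¬p p)
          ... | inj₂ p = p

      ⟦⟧-⟨,⟩ : ∀ f g → ⟨ ⟦ f ⟧ , ⟦ g ⟧ ⟩ⱽ ≈ ⟦ (λ α → ⟨ f α , g α ⟩ⱽ) ⟧
      ⟦⟧-⟨,⟩ f g = ≈-trans _ _ _
        ([,]-cong (⟦⟧-[,] f f) (⟦⟧-[,] f g)) (⟦⟧-[,] _ _)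

      M-transitive : ∀ {y z} → M 𝒰 em uf σ y → z ∈ⱽ y → M 𝒰 em uf σ z
      M-transitive {y} (f , e) m =
        let (g , _ , e′) = ∈-⟦⟧⁻ f (∈-resp y ⟦ f ⟧ _ e m) in g , e′

      -- Dodd soundness in terms of representing functions.

      module _ {_<_ : Rel K 0ℓ} (κ : IsRegularUncountableCardinal _<_)
               (sound : DoddSound 𝒰 em uf σ κ) where

        private
          d : V
          d = proj₁ sound

        -- Represents the function X ↦ j X ∩ [ id ].
        soundness : K → V
        soundness = proj₁ (proj₁ (proj₂ sound))

        private
          d≈ : d ≈ ⟦ soundness ⟧
          d≈ = proj₂ (proj₁ (proj₂ sound))

          j-∩ : ∀ X → (j 𝒰 em uf σ X ∩ⱽ ⟦ ordinal κ ⟧) ≈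
                      ⟦ (λ α → X ∩ⱽ ordinal κ α) ⟧
          j-∩ X = ⟦⟧-∩ (const X) (ordinal κ)

        initial-segments-guessed : ∀ X → X ⊆ⱽ κⱽ κ →
          ∃ λ x → _∈ᵁ_ 𝒰 (λ α → ⟨ x α , X ∩ⱽ ordinal κ α ⟩ⱽ) soundness
        initial-segments-guessed X X⊆κ =
          x , ⟦⟧-∈⁻ _ soundness (∈-respˡ ⟦ soundness ⟧ (≈-sym _ _ z≈) z∈)
          where
          z : V
          z = ⟨ X , j 𝒰 em uf σ X ∩ⱽ ⟦ ordinal κ ⟧ ⟩ⱽ

          z∈ : z ∈ⱽ ⟦ soundness ⟧
          z∈ = ∈-resp d ⟦ soundness ⟧ z d≈
            (Equivalence.from (proj₂ (proj₂ sound) z) (X , X⊆κ , ≈-refl z))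

          -- Transitivity of `M` is followed down the Kuratowski pair, from `z` through `[ X , X ]ⱽ`
          -- to `X`.
          X∈M : M 𝒰 em uf σ X
          X∈M = M-transitive
            (M-transitive (M-transitive (soundness , ≈-refl ⟦ soundness ⟧) z∈)
              (element-∈ z false))
            (element-∈ [ X , X ]ⱽ false)

          x : K → V
          x = proj₁ X∈M

          z≈ : z ≈ ⟦ (λ α → ⟨ x α , X ∩ⱽ ordinal κ α ⟩ⱽ) ⟧
          z≈ = ≈-trans _ _ _ (⟨,⟩-cong (proj₂ X∈M) (j-∩ X)) (⟦⟧-⟨,⟩ _ _)

        -- The pair represented by `x` and `y` belongs to `d`, so its second coordinate is
        -- `j X ∩ [id]` for some `X`; injectivity of the collapse brings this equality back to the
        -- representatives.
        guesses-are-initial-segments : ∀ x y →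
          _∈ᵁ_ 𝒰 (λ α → ⟨ x α , y α ⟩ⱽ) soundness →
          ∃ λ X → _=ᵁ_ 𝒰 y (λ α → X ∩ⱽ ordinal κ α)
        guesses-are-initial-segments x y m =
          let z = ⟦ (λ α → ⟨ x α , y α ⟩ⱽ) ⟧
              (X , _ , e) = Equivalence.to (proj₂ (proj₂ sound) z)
                (∈-resp ⟦ soundness ⟧ d z (≈-sym _ _ d≈)
                  (∈-⟦⟧⁺ soundness _ m (≈-refl z)))
          in X , ⟦⟧-injective _ _ (≈-trans _ _ _
                   (⟨,⟩-injectiveʳ (≈-trans _ _ _ (⟦⟧-⟨,⟩ x y) e)) (j-∩ X))

-- Subsets as characteristic functions.

module _ (em : ExcludedMiddle 0ℓ) (ext : Extensionality 0ℓ 0ℓ) where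

  T-injective : ∀ {a b} → (T a → T b) → (T b → T a) → a ≡ b
  T-injective {false} {false} _ _ = refl
  T-injective {false} {true}  _ q = ⊥-elim (q tt)
  T-injective {true}  {false} p _ = ⊥-elim (p tt)
  T-injective {true}  {true}  _ _ = refl

  -- Lets the sequence in the Galvin property be indexed by the subsets of κ themselves.
  characteristic : (K : Set) → Bijection (setoid (K → Bool)) (≐-setoid K 0ℓ)
  characteristic K = record
    { to        = λ b α → T (b α)
    ; cong      = λ { refl → (λ p → p) , (λ p → p) }
    ; bijective = (λ (p , q) → ext λ α → T-injective p q)
                , λ P → (λ α → ⌊ em {P = P α} ⌋) ,
                    λ { refl → toWitness , fromWitness }
    }

-- Diagonal guessing.

module _ {K : Set} (_<_ : Rel K 0ℓ) (𝒰 : Family K) where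

  -- Here α ∈ G X plays the role of X ∩ α ∈ 𝒜 α.
  DiagonalGuessing : Set₁
  DiagonalGuessing = ∃ λ (G : (K → Bool) → Pred K 0ℓ) →
    (∀ X → G X ∈ 𝒰) ×
    ((X : K → K → Bool) → (λ α → α ∈ G (X α)) ∈ 𝒰 →
       ∃ λ (Y : K → Bool) → (λ α → ∀ β → β < α → X α β ≡ Y β) ∈ 𝒰)

  ¬PPoint⇒∃ : (∀ {ℓ} → ExcludedMiddle ℓ) → ¬ PPoint 𝒰 _<_ →
              ∃ λ f → UnboundedMod 𝒰 _<_ f × ¬ AlmostOneToOneMod 𝒰 _<_ f
  ¬PPoint⇒∃ em ¬p = decidable-stable em λ ¬e →
    ¬p λ f u → decidable-stable em λ ¬a → ¬e (f , u , ¬a)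

module _ (em : ∀ {ℓ} → ExcludedMiddle ℓ) (ext : Extensionality 0ℓ 0ℓ)
         {K : Set} {_<_ : Rel K 0ℓ} (κ : IsRegularUncountableCardinal _<_)
         {𝒰 : Family K} (uf : IsUltrafilter 𝒰) where

  open IsUltrafilter uf
  open IsRegularUncountableCardinal κ using (isStrictTotalOrder)
  open IsStrictTotalOrder isStrictTotalOrder using (compare) renaming (trans to <-trans)

  doddSound⇒diagonalGuessing : ∀ σ → DoddSound 𝒰 em uf σ κ →
                               DiagonalGuessing _<_ 𝒰
  doddSound⇒diagonalGuessing σ sound = G , (λ X → proj₂ (guess X)) , diagonal
    where
    D : K → V
    D = soundness uf em σ κ sound

    set : (K → Bool) → V
    set X = subsetⱽ κ (λ α → T (X α))

    guess : ∀ X → ∃ λ x → _∈ᵁ_ 𝒰 (λ α → ⟨ x α , set X ∩ⱽ ordinal κ α ⟩ⱽ) D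
    guess X = initial-segments-guessed uf em σ κ sound (set X) (subsetⱽ-⊆ κ _)

    -- The first coordinate is kept, so that a diagonal choice of sets yields a function into pairs
    -- that is a member of `D` in the ultrapower.
    G : (K → Bool) → Pred K 0ℓ
    G X α = ⟨ proj₁ (guess X) α , set X ∩ⱽ ordinal κ α ⟩ⱽ ∈ⱽ D α

    diagonal : (X : K → K → Bool) → (λ α → α ∈ G (X α)) ∈ 𝒰 →
               ∃ λ (Y : K → Bool) → (λ α → ∀ β → β < α → X α β ≡ Y β) ∈ 𝒰
    diagonal X m = restrict-Y (guesses-are-initial-segments uf em σ κ sound
      (λ α → proj₁ (guess (X α)) α) (λ α → set (X α) ∩ⱽ ordinal κ α) m)
      where
      restrict-Y : (∃ λ Y → _=ᵁ_ 𝒰 (λ α → set (X α) ∩ⱽ ordinal κ α)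
                                   (λ α → Y ∩ⱽ ordinal κ α)) →
                   ∃ λ (Y : K → Bool) → (λ α → ∀ β → β < α → X α β ≡ Y β) ∈ 𝒰
      restrict-Y (Y , n) = (λ β → ⌊ em {P = ordinal κ β ∈ⱽ Y} ⌋) ,
        upward (λ {α} e β β<α → T-injective em ext
          (λ t → fromWitness (ordinal-∈-resp κ (set (X α)) Y e β<α
                                (ordinal-∈-subsetⱽ⁺ κ {P = λ γ → T (X α γ)} t)))
          (λ t → ordinal-∈-subsetⱽ⁻ κ {P = λ γ → T (X α γ)}
                   (ordinal-∈-resp κ Y (set (X α)) (≈-sym _ _ e) β<α (toWitness t)))) n

  -- Failure of the Galvin property.

  unbounded⇒cofinal : ∀ {P : Pred K 0ℓ} → ¬ Bounded _<_ P →
                      ∀ β → ∃ λ α → α ∈ P × β < α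
  unbounded⇒cofinal {P} ¬b β = decidable-stable em λ ¬q → ¬b (γ , bound ¬q)
    where
    -- `Bounded` asks for a strict bound, and `β` itself may lie in `P`; hence a `γ` above `β`.
    γ : K
    γ = proj₁ (no-maximum κ em β)

    β<γ : β < γ
    β<γ = proj₂ (no-maximum κ em β)

    bound : ¬ (∃ λ α → α ∈ P × β < α) → ∀ α → α ∈ P → α < γ
    bound ¬q α m with compare β α
    ... | tri< β<α _ _  = ⊥-elim (¬q (α , m , β<α))
    ... | tri≈ _ refl _ = β<γ
    ... | tri> _ _ α<β  = <-trans α<β β<γ

  diagonalGuessing⇒nonGalvin : DiagonalGuessing _<_ 𝒰 →
    ∀ f → UnboundedMod 𝒰 _<_ f → ¬ AlmostOneToOneMod 𝒰 _<_ f → NonGalvin 𝒰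
  diagonalGuessing⇒nonGalvin (G , guessed , diagonal) f unbounded ¬1-1 galvin
    with galvin (K → Bool) (characteristic em ext K) G guessed
  ... | I , (X , X-injective , I⇔X) , homogeneous
    with diagonal (X ∘ f) (upward
           (λ {α} h → h (X (f α)) (Equivalence.from (I⇔X _) (f α , refl)))
           homogeneous)
  ... | Y , agree = proper (upward (λ c → ⊥-elim (f-nonconstant c)) cofinal)
    where
    -- The fibres are taken inside the set where `X (f α′)` and `Y` agree below `α′`.
    Cofinal : Pred K 0ℓ
    Cofinal α =
      ¬ Bounded _<_ (λ α′ → (∀ β → β < α′ → X (f α′) β ≡ Y β) × f α′ ≡ f α)

    cofinal : Cofinal ∈ 𝒰
    cofinal = fibre-unbounded uf em ¬1-1 agree

    X∘f≡Y : ∀ {α} → α ∈ Cofinal → X (f α) ≡ Y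
    -- To compare at `β`, move along the fibre to some `α′` above `β`; this leaves `X (f α)`
    -- unchanged.
    X∘f≡Y c = ext λ β →
      let (α′ , (a , e) , β<α′) = unbounded⇒cofinal c β
      in trans (cong (λ γ → X γ β) (sym e)) (a β β<α′)

    f-nonconstant : ∀ {α} → ¬ (α ∈ Cofinal)
    f-nonconstant {α} c =
      let (γ , fα<γ) = no-maximum κ em (f α)
      -- On `Cofinal` all `X (f α′)` equal `Y`, so injectivity of `X` makes `f` constant there, with
      -- a value below `γ`.
      in unbounded γ (upward
           (λ c′ → subst (_< γ) (X-injective (trans (X∘f≡Y c) (sym (X∘f≡Y c′)))) fα<γ)
           cofinal)

corollary3p11 : (cl : Classical) →
    {K : Set} {_<_ : Rel K 0ℓ} (κ : IsRegularUncountableCardinal _<_) →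
    (𝒰 : Family K) (uf : IsUltrafilter 𝒰) (σ : σ-Complete 𝒰) →
    DoddSound 𝒰 (Classical.em cl) uf σ κ →
    ¬ PPoint 𝒰 _<_ →
    NonGalvin 𝒰
corollary3p11 cl {_<_ = _<_} κ 𝒰 uf σ sound ¬p =
  let (f , unbounded , ¬1-1) = ¬PPoint⇒∃ _<_ 𝒰 em ¬p
  in diagonalGuessing⇒nonGalvin em ext κ uf
       (doddSound⇒diagonalGuessing em ext κ uf σ sound) f unbounded ¬1-1
  where open Classical cl
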